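{- Let $k\ge 1$ be an integer and assume the Erdős girth conjecture. Then for any distance oracle for undirected unweighted graphs that uses $o(n^{1+1/k})$ space (bits) on $n$-vertex graphs, there exist an input graph $G=(V,E)$ and two vertices $u,v\in V$ such that $d(u,v)=2$ and the estimate returned by the oracle satisfies $\hat{d}(u,v) \ge 2k+2$.
   Context: The girth of a graph is the length of its shortest cycle. The Erdős girth conjecture asserts that, for every integer $k\ge 1$, there exist $n$-vertex graphs with $\Omega(n^{1+1/k})$ edges and girth at least $2k+2$. $d(u,v)$ is the length of a shortest path between $u$ and $v$ in $G$. A distance oracle is a data structure obtained by preprocessing $G$; a query algorithm, given any pair $u,v\in V$ and access only to the data structure, returns an estimate $\hat d(u,v)$. The estimate is the length of a path between $u$ and $v$ in $G$, and in particular $d(u,v)\le\hat d(u,v)$. -}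

module Defs where

open import Data.Bool using (Bool; T)
open import Data.Bool.Properties using (T?)
open import Data.Fin using (Fin; _<?_)
open import Data.List using (List; []; _∷_; length; filter; allFin; cartesianProduct)
open import Data.List.Relation.Unary.Unique.Propositional using (Unique)
open import Data.Nat using (ℕ; suc; _+_; _*_; _^_; _≤_)
open import Data.Product using (_×_; _,_; ∃-syntax)
open import Relation.Binary using (Symmetric)
open import Relation.Binary.Construct.Add.Supremum.NonStrict _≤_ using (_≤⁺_) public
open import Relation.Nullary using (¬_)
open import Relation.Nullary.Construct.Add.Supremum using (_⁺; ⊤⁺; [_]) public
open import Relation.Nullary.Decidable using (_×-dec_)

record Graph (n : ℕ) : Set where
  field
    adjacent? : Fin n → Fin n → Bool

  Adj : Fin n → Fin n → Set
  Adj u v = T (adjacent? u v)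

  field
    symmetric   : Symmetric Adj
    irreflexive : ∀ {v} → ¬ Adj v v

  -- Each undirected edge is listed once, as the pair (u , v) with u < v.
  edges : List (Fin n × Fin n)
  edges = filter (λ (u , v) → (u <? v) ×-dec T? (adjacent? u v))
                 (cartesianProduct (allFin n) (allFin n))

  edgeCount : ℕ
  edgeCount = length edges

open Graph public using (Adj; edgeCount)

module _ {n : ℕ} (G : Graph n) where

  -- Vertices may repeat; the last index is the number of edges.
  data Walk : Fin n → Fin n → ℕ → Set where
    nil  : ∀ {u} → Walk u u 0
    cons : ∀ {u v w l} → Adj G u v → Walk v w l → Walk u w (suc l)

  vertices : ∀ {u v l} → Walk u v l → List (Fin n)
  vertices (nil {u})          = u ∷ []
  vertices (cons {u = u} _ p) = u ∷ vertices p

  -- A simple path on at least three vertices, closed up by one more edge.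
  data Cycle : ℕ → Set where
    close : ∀ {u v l} (p : Walk u v l) → Unique (vertices p) →
            2 ≤ l → Adj G v u → Cycle (suc l)

-- The minimum of { m ∣ P m } in ℕ ∪ {∞}, with ⊤⁺ = ∞ for the empty set.
IsMinimum : (ℕ → Set) → ℕ ⁺ → Set
IsMinimum P [ m ] = P m × (∀ l → P l → m ≤ l)
IsMinimum P ⊤⁺    = ∀ l → ¬ P l

IsDistance : ∀ {n} → Graph n → Fin n → Fin n → ℕ ⁺ → Set
IsDistance G u v = IsMinimum (Walk G u v)

IsGirth : ∀ {n} → Graph n → ℕ ⁺ → Set
IsGirth G = IsMinimum (Cycle G)

-- m ≥ (1/c) n^(1+1/k) is written, without roots, as n^(k+1) ≤ (c m)^k.
ErdősGirthConjecture : Set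
ErdősGirthConjecture =
  ∀ k → 1 ≤ k →
  ∃[ c ] ∃[ N ] ∀ n → N ≤ n →
  ∃[ G ] n ^ suc k ≤ (c * edgeCount {n} G) ^ k
       × (∃[ g ] IsGirth G g × [ 2 * k + 2 ] ≤⁺ g)

-- s(n) = o(n^(1+1/k)): for every c, eventually s(n) ≤ (1/c) n^(1+1/k).
IsLittleO : ℕ → (ℕ → ℕ) → Set
IsLittleO k s = ∀ c → ∃[ N ] ∀ n → N ≤ n → (c * s n) ^ k ≤ n ^ suc k

-- The estimate is ∞ exactly when no path joins the two vertices.
IsEstimate : ∀ {n} → Graph n → Fin n → Fin n → ℕ ⁺ → Set
IsEstimate G u v [ l ] = Walk G u v l
IsEstimate G u v ⊤⁺    = ∀ l → ¬ Walk G u v l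

-- The query sees only the stored bits, the two vertices and n (the latter
-- through the type of the vertices).
record DistanceOracle : Set where
  field
    preprocess : ∀ {n} → Graph n → List Bool
    query      : ∀ {n} → List Bool → Fin n → Fin n → ℕ ⁺

  estimate : ∀ {n} → Graph n → Fin n → Fin n → ℕ ⁺
  estimate G = query (preprocess G)

  field
    estimate-valid : ∀ {n} (G : Graph n) u v → IsEstimate G u v (estimate G u v)

open DistanceOracle public using (estimate)

UsesSpace : DistanceOracle → (ℕ → ℕ) → Set
UsesSpace O s = ∀ {n} (G : Graph n) → length (DistanceOracle.preprocess O G) ≤ s n

{-# OPTIONS --safe #-}

-- Hang a pendant vertex u′ on every vertex u of a graph H of girth at least
-- 2k+2.  H has m edges, hence 2^m subgraphs, while the oracle stores fewer than
-- m bits on each of them (with its pendant vertices): two of the subgraphs get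
-- the same data.  Say the edge uv is in the first but not in the second.  In the
-- first, d(u′,v) = 2; in the second, every walk from u to v closes up with uv to
-- a cycle of H, so u′ and v are at distance at least 1 + (2k+1).  The common
-- estimate is valid in both.
module Submission where

open import Data.Bool using (Bool; true; false; T)
open import Data.Bool.Properties using (T?)
open import Data.Fin using (Fin; _<?_; _↑ˡ_; _↑ʳ_; splitAt; combine; finToFun; funToFin; fromℕ<)
  renaming (_<_ to _<ᶠ_; _≟_ to _≟ᶠ_)
open import Data.Fin.Patterns using (0F; 1F)
open import Data.Fin.Properties using
  ( any?; pigeonhole; fromℕ<-injective; ¬∀⟶∃¬; funToFin-finToFin
  ; splitAt-↑ˡ; splitAt-↑ʳ )
  renaming (<-irrefl to <ᶠ-irrefl; <-asym to <ᶠ-asym; <⇒≢ to <ᶠ⇒≢)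
open import Data.Empty using (⊥)
open import Data.List using (List; []; _∷_; length; lookup; allFin; cartesianProduct)
open import Data.List.Membership.Propositional using (_∈_)
open import Data.List.Membership.Propositional.Properties using (∈-lookup; ∈-filter⁻)
open import Data.List.Relation.Unary.All using ([])
  renaming (lookup to lookupAll)
open import Data.List.Relation.Unary.All.Properties using (¬Any⇒All¬)
open import Data.List.Relation.Unary.Any using (here; there)
  renaming (any? to anyᴸ?)
open import Data.List.Relation.Unary.AllPairs using ([]; _∷_)
open import Data.List.Relation.Unary.Unique.Propositional using (Unique)
open import Data.List.Relation.Unary.Unique.Propositional.Properties using
  (filter⁺; allFin⁺; cartesianProduct⁺)
open import Data.Nat using
  (ℕ; zero; suc; _+_; _*_; _^_; _∸_; _⊔_; _≤_; _<_; z≤n; s≤s)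
open import Data.Nat.Binary using (ℕᵇ; 2[1+_]; 1+[2_]; toℕ)
  renaming (zero to 0ᵇ)
open import Data.Nat.Binary.Properties using (toℕ-injective; 2[1+_]-injective; 1+[2_]-injective)
open import Data.Nat.Properties hiding (_<?_)
open import Data.Product using (_×_; _,_; proj₁; proj₂; ∃-syntax; -,_)
open import Data.Product.Properties using (≡-dec)
open import Data.Sum using (_⊎_; inj₁; inj₂; swap; [_,_]′)
open import Function using (id; _∘_)
open import Level using (0ℓ)
open import Relation.Binary using (Rel; Decidable; DecidableEquality)
open import Relation.Binary.PropositionalEquality
open import Relation.Binary.Construct.Add.Supremum.NonStrict _≤_ using ([_]; _≤⊤⁺)
open import Relation.Unary using () renaming (Decidable to UnaryDecidable)
open import Relation.Nullary using (¬_; yes; no; contradiction)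
open import Relation.Nullary.Decidable using
  (⌊_⌋; toWitness; fromWitness; _×-dec_; _⊎-dec_)
open import Defs

-- Graphs and walks

module FromRelation {n} {R : Rel (Fin n) 0ℓ} (R? : Decidable R)
                    (R-sym : ∀ u v → R u v → R v u) (R-irrefl : ∀ v → ¬ R v v) where

  graph : Graph n
  graph = record
    { adjacent?   = λ u v → ⌊ R? u v ⌋
    ; symmetric   = λ {u} {v} uv → fromWitness {a? = R? v u} (R-sym u v (toWitness {a? = R? u v} uv))
    ; irreflexive = λ {v} vv → R-irrefl v (toWitness {a? = R? v v} vv)
    }

  adj⁺ : ∀ u v → R u v → Adj graph u v
  adj⁺ u v = fromWitness {a? = R? u v}

  adj⁻ : ∀ u v → Adj graph u v → R u v
  adj⁻ u v = toWitness {a? = R? u v}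

module _ {n} {G : Graph n} where

  SimplePath≤ : Fin n → Fin n → ℕ → Set
  SimplePath≤ u v l = ∃[ l′ ] l′ ≤ l × ∃[ p ] Unique (vertices G {u} {v} {l′} p)

  SimplePath≤-mono : ∀ {u v l m} → l ≤ m → SimplePath≤ u v l → SimplePath≤ u v m
  SimplePath≤-mono l≤m (l′ , l′≤l , p) = l′ , ≤-trans l′≤l l≤m , p

  suffixFrom : ∀ {u v w l} (p : Walk G v w l) → u ∈ vertices G p →
               Unique (vertices G p) → SimplePath≤ u w l
  suffixFrom nil           (here refl) !p       = 0 , z≤n , nil , !p
  suffixFrom p@(cons _ _)  (here refl) !p       = -, ≤-refl , p , !p
  suffixFrom (cons _ p)    (there u∈p) (_ ∷ !p) =
    SimplePath≤-mono (n≤1+n _) (suffixFrom p u∈p !p)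

  -- If the first vertex already lies on the simple path obtained from the tail, the part of that
  -- path from there on replaces the whole walk; otherwise prepending the edge keeps the path
  -- simple.
  eraseLoops : ∀ {u v l} → Walk G u v l → SimplePath≤ u v l
  eraseLoops nil = 0 , z≤n , nil , [] ∷ []
  eraseLoops {u} (cons e p) with eraseLoops p
  ... | l′ , l′≤l , q , !q with anyᴸ? (u ≟ᶠ_) (vertices G q)
  ...   | yes u∈q = SimplePath≤-mono (m≤n⇒m≤1+n l′≤l) (suffixFrom q u∈q !q)
  ...   | no  u∉q = suc l′ , s≤s l′≤l , cons e q , ¬Any⇒All¬ _ u∉q ∷ !q

module _ {n} {G H : Graph n} (G⊆H : ∀ {u v} → Adj G u v → Adj H u v) where

  mapWalk : ∀ {u v l} → Walk G u v l → Walk H u v l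
  mapWalk nil        = nil
  mapWalk (cons e p) = cons (G⊆H e) (mapWalk p)

  vertices-mapWalk : ∀ {u v l} (p : Walk G u v l) →
                     vertices H (mapWalk p) ≡ vertices G p
  vertices-mapWalk nil        = refl
  vertices-mapWalk (cons e p) = cong (_ ∷_) (vertices-mapWalk p)

  girth≤detour : ∀ {g} → (∀ l → Cycle H l → g ≤ l) →
                 ∀ {u v l} → Adj H u v → ¬ Adj G u v → Walk G u v l → g ≤ suc l
  girth≤detour girth {u} {v} uv∈H uv∉G walk with eraseLoops walk
  -- `close` demands a path with at least two edges. Length 0 would make `uv` a loop of `H`, and
  -- length 1 would be the edge `uv` itself, which `G` lacks.
  ... | _ , _ , nil , _ = contradiction uv∈H (Graph.irreflexive H)
  ... | _ , _ , cons e nil , _ = contradiction e uv∉G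
  ... | _ , l′≤l , p@(cons _ (cons _ _)) , !p =
    ≤-trans (girth _ (close (mapWalk p) (subst Unique (sym (vertices-mapWalk p)) !p)
                            (s≤s (s≤s z≤n)) (Graph.symmetric H uv∈H)))
            (s≤s l′≤l)

≤girth⇒≤cycles : ∀ {n} {G : Graph n} {m g} → IsGirth G g → [ m ] ≤⁺ g →
                 ∀ l → Cycle G l → m ≤ l
≤girth⇒≤cycles (_ , minimal) [ m≤g ]   l C = ≤-trans m≤g (minimal l C)
≤girth⇒≤cycles acyclic       (_ ≤⊤⁺)   l C = contradiction C (acyclic l)

-- Edge subsets as subgraphs

module _ {n} (H : Graph n) (S : Fin n × Fin n → Bool) where

  -- S is only consulted on the pairs listed by edges, those with u < v.
  Chosen : Rel (Fin n) 0ℓ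
  Chosen u v = u <ᶠ v × T (Graph.adjacent? H u v) × T (S (u , v))

  chosen? : Decidable Chosen
  chosen? u v = (u <? v) ×-dec T? _ ×-dec T? _

  private
    module Sub = FromRelation (λ u v → chosen? u v ⊎-dec chosen? v u) (λ _ _ → swap)
                              (λ _ → [ <ᶠ-irrefl refl ∘ proj₁ , <ᶠ-irrefl refl ∘ proj₁ ]′)

  subgraph : Graph n
  subgraph = Sub.graph

  subgraph-adj⁺ : ∀ {u v} → Chosen u v → Adj subgraph u v
  subgraph-adj⁺ = Sub.adj⁺ _ _ ∘ inj₁

  subgraph-adj⁻ : ∀ {u v} → Adj subgraph u v → Chosen u v ⊎ Chosen v u
  subgraph-adj⁻ = Sub.adj⁻ _ _

  subgraph⊆ : ∀ {u v} → Adj subgraph u v → Adj H u v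
  subgraph⊆ uv with subgraph-adj⁻ uv
  ... | inj₁ (_ , uv∈H , _) = uv∈H
  ... | inj₂ (_ , vu∈H , _) = Graph.symmetric H vu∈H

-- Pendant vertices

module _ {n} (G : Graph n) where

  -- inj₂ u is the pendant vertex of inj₁ u.
  PendantAdj : Rel (Fin n ⊎ Fin n) 0ℓ
  PendantAdj (inj₁ u) (inj₁ v) = Adj G u v
  PendantAdj (inj₁ u) (inj₂ v) = u ≡ v
  PendantAdj (inj₂ u) (inj₁ v) = u ≡ v
  PendantAdj (inj₂ u) (inj₂ v) = ⊥

  private
    dec : Decidable PendantAdj
    dec (inj₁ u) (inj₁ v) = T? _
    dec (inj₁ u) (inj₂ v) = u ≟ᶠ v
    dec (inj₂ u) (inj₁ v) = u ≟ᶠ v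
    dec (inj₂ u) (inj₂ v) = no id

    symm : ∀ a b → PendantAdj a b → PendantAdj b a
    symm (inj₁ u) (inj₁ v) = Graph.symmetric G
    symm (inj₁ u) (inj₂ v) = sym
    symm (inj₂ u) (inj₁ v) = sym

    irrefl : ∀ a → ¬ PendantAdj a a
    irrefl (inj₁ u) = Graph.irreflexive G

    module Pendants = FromRelation {n + n} (λ x y → dec (splitAt n x) (splitAt n y))
                                   (λ x y → symm (splitAt n x) (splitAt n y))
                                   (λ x → irrefl (splitAt n x))

  withPendants : Graph (n + n)
  withPendants = Pendants.graph

  base : Fin n → Fin (n + n)
  base = _↑ˡ n

  pendant : Fin n → Fin (n + n)
  pendant = n ↑ʳ_

  private
    adj⁺ : ∀ {x y a b} → splitAt n x ≡ a → splitAt n y ≡ b →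
           PendantAdj a b → Adj withPendants x y
    adj⁺ {x} {y} refl refl = Pendants.adj⁺ x y

    pendantAdj⁻ : ∀ {u} b → PendantAdj (inj₂ u) b → b ≡ inj₁ u
    pendantAdj⁻ (inj₁ _) refl = refl

  base-adj : ∀ {u v} → Adj G u v → Adj withPendants (base u) (base v)
  base-adj {u} {v} = adj⁺ (splitAt-↑ˡ n u n) (splitAt-↑ˡ n v n)

  pendant-adj : ∀ {u} → Adj withPendants (pendant u) (base u)
  pendant-adj {u} = adj⁺ (splitAt-↑ʳ n n u) (splitAt-↑ˡ n u n) refl

  pendant-neighbour : ∀ {u y} → Adj withPendants (pendant u) y → splitAt n y ≡ inj₁ u
  pendant-neighbour {u} {y} e =
    pendantAdj⁻ (splitAt n y)
      (subst (λ a → PendantAdj a (splitAt n y)) (splitAt-↑ʳ n n u) (Pendants.adj⁻ (pendant u) y e))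

  foot : Fin (n + n) → Fin n
  foot = [ id , id ]′ ∘ splitAt n

  foot-base : ∀ u → foot (base u) ≡ u
  foot-base u = cong [ id , id ]′ (splitAt-↑ˡ n u n)

  private
    step : ∀ {w l} a b → PendantAdj a b → Walk G ([ id , id ]′ b) w l →
           ∃[ l′ ] l′ ≤ suc l × Walk G ([ id , id ]′ a) w l′
    step (inj₁ u) (inj₁ v) e    p = -, ≤-refl , cons e p
    step (inj₁ u) (inj₂ v) refl p = -, n≤1+n _ , p
    step (inj₂ u) (inj₁ v) refl p = -, n≤1+n _ , p

  -- `foot` retracts onto `G`: edges of `G` survive and pendant edges collapse, so the length can
  -- only drop.
  foot-walk : ∀ {x y l} → Walk withPendants x y l →
              ∃[ l′ ] l′ ≤ l × Walk G (foot x) (foot y) l′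
  foot-walk nil = -, z≤n , nil
  foot-walk (cons {u = x} {v = y} e p) with foot-walk p
  ... | _ , l′≤l , q with step (splitAt n x) (splitAt n y) (Pendants.adj⁻ x y e) q
  ...   | _ , l″≤ , r = -, ≤-trans l″≤ (s≤s l′≤l) , r

  pendant≢base : ∀ {u v} → pendant u ≢ base v
  pendant≢base {u} {v} eq
    with () ← trans (sym (splitAt-↑ʳ n n u)) (trans (cong (splitAt n) eq) (splitAt-↑ˡ n v n))

  -- The inequality is strict because the walk must leave `pendant u` along its only edge, which
  -- collapses under `foot`.
  pendant-walk : ∀ {u v l} → Walk withPendants (pendant u) (base v) l →
                 ∃[ l′ ] l′ < l × Walk G u v l′
  -- The endpoints become variables with equations, since unifying `pendant u` with `base v` in the
  -- case `nil` would get stuck.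
  pendant-walk {u} {v} w = go w refl refl
    where
    go : ∀ {x y l} → Walk withPendants x y l → x ≡ pendant u → y ≡ base v →
         ∃[ l′ ] l′ < l × Walk G u v l′
    go nil refl eq = contradiction eq pendant≢base
    go (cons {v = y} e p) refl refl with foot-walk p
    ... | l′ , l′≤l , q =
      l′ , s≤s l′≤l ,
      subst₂ (λ a b → Walk G a b l′)
             (cong [ id , id ]′ (pendant-neighbour {u} {y} e)) (foot-base v) q

  -- For the lower bound, a walk with fewer than two edges would project to the empty walk, and then
  -- the edge `uv` would be a loop.
  pendant-distance : ∀ {u v} → Adj G u v → IsDistance withPendants (pendant u) (base v) [ 2 ]
  pendant-distance {u} {v} uv =
    cons (pendant-adj {u}) (cons (base-adj uv) nil) , λ l p → lower (pendant-walk p)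
    where
    lower : ∀ {l} → ∃[ l′ ] l′ < l × Walk G u v l′ → 2 ≤ l
    lower (_ , _      , nil)      = contradiction uv (Graph.irreflexive G)
    lower (_ , 1+l′<l , cons _ _) = ≤-trans (s≤s (s≤s z≤n)) 1+l′<l

-- Counting bit strings

-- Bijective base-2 numeration: strings of length at most l get the codes below 2^(l+1) − 1.
code : List Bool → ℕᵇ
code []           = 0ᵇ
code (false ∷ bs) = 1+[2 code bs ]
code (true  ∷ bs) = 2[1+ code bs ]

code-injective : ∀ as bs → code as ≡ code bs → as ≡ bs
code-injective []           []           _  = refl
code-injective []           (false ∷ bs) ()
code-injective []           (true  ∷ bs) ()
code-injective (false ∷ as) (false ∷ bs) eq = cong (false ∷_) (code-injective as bs (1+[2_]-injective eq))
code-injective (true  ∷ as) (true  ∷ bs) eq = cong (true ∷_) (code-injective as bs (2[1+_]-injective eq))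

-- The summand 2 makes the induction a plain doubling: one more digit takes a code x to at most 2(x
-- + 1), and 2 + 2(x + 1) = 2(2 + x).
code-bound : ∀ bs → 2 + toℕ (code bs) ≤ 2 ^ suc (length bs)
code-bound []       = ≤-refl
code-bound (b ∷ bs) = ≤-trans (digit b) (*-monoʳ-≤ 2 (code-bound bs))
  where
  2+2* : ∀ x → 2 + 2 * suc x ≡ 2 * (2 + x)
  2+2* x = sym (*-suc 2 (suc x))

  digit : ∀ b → 2 + toℕ (code (b ∷ bs)) ≤ 2 * (2 + toℕ (code bs))
  digit true  = ≤-reflexive (2+2* _)
  digit false = ≤-trans (+-monoʳ-≤ 2 (≤-trans (n≤1+n _) (≤-reflexive (sym (*-suc 2 _)))))
                        (≤-reflexive (2+2* _))

-- Only 2^m - 1 strings are shorter than m, one fewer than there are arguments.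
bitsPigeonhole : ∀ {m} (f : Fin (2 ^ m) → List Bool) → (∀ i → length (f i) < m) →
                 ∃[ i ] ∃[ j ] i ≢ j × f i ≡ f j
bitsPigeonhole {m} f short =
  let i , j , i<j , eq = pigeonhole 2^m∸1<2^m (λ i → fromℕ< (bound i))
  in  i , j , <ᶠ⇒≢ i<j ,
      code-injective (f i) (f j) (toℕ-injective (fromℕ<-injective _ _ (bound i) (bound j) eq))
  where
  bound : ∀ i → toℕ (code (f i)) < 2 ^ m ∸ 1
  bound i = ∸-monoˡ-≤ 1 (≤-trans (code-bound (f i)) (^-monoʳ-≤ 2 (short i)))

  2^m∸1<2^m : 2 ^ m ∸ 1 < 2 ^ m
  2^m∸1<2^m = ∸-monoʳ-< (s≤s z≤n) (m^n>0 2 m)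

-- Subsets of a duplicate-free list

lookup-injective : ∀ {A : Set} {xs : List A} → Unique xs →
                   ∀ i j → lookup xs i ≡ lookup xs j → i ≡ j
lookup-injective (_  ∷ _)   0F            0F            _  = refl
lookup-injective (x∉ ∷ _)   0F            (Fin.suc j)   eq = contradiction eq (lookupAll x∉ (∈-lookup j))
lookup-injective (x∉ ∷ _)   (Fin.suc i)   0F            eq = contradiction (sym eq) (lookupAll x∉ (∈-lookup i))
lookup-injective (_  ∷ !xs) (Fin.suc i)   (Fin.suc j)   eq = cong Fin.suc (lookup-injective !xs i j eq)

funToFin-cong : ∀ {m n} {f g : Fin m → Fin n} → f ≗ g → funToFin f ≡ funToFin g
funToFin-cong {zero}  f≗g = refl
funToFin-cong {suc m} f≗g = cong₂ combine (f≗g 0F) (funToFin-cong (f≗g ∘ Fin.suc))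

-- A number is recovered from its base-m digits, so two numbers agreeing in every digit would be
-- equal.
finToFun-≢ : ∀ {m n} (i j : Fin (m ^ n)) → i ≢ j →
             ∃[ e ] finToFun {m} {n} i e ≢ finToFun j e
finToFun-≢ {m} {n} i j i≢j = ¬∀⟶∃¬ n _ (λ e → finToFun i e ≟ᶠ finToFun j e) λ eq →
  i≢j (trans (sym (funToFin-finToFin {n} i))
             (trans (funToFin-cong eq) (funToFin-finToFin {n} j)))

module _ {A : Set} (_≟_ : DecidableEquality A) {xs : List A} (!xs : Unique xs) where

  private
    selected? : (χ : Fin (length xs) → Fin 2) →
                UnaryDecidable (λ x → ∃[ e ] lookup xs e ≡ x × χ e ≡ 1F)
    selected? χ x = any? (λ e → (lookup xs e ≟ x) ×-dec (χ e ≟ᶠ 1F))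

    subset : (Fin (length xs) → Fin 2) → A → Bool
    subset χ x = ⌊ selected? χ x ⌋

    ∈-subset : ∀ χ e → χ e ≡ 1F → T (subset χ (lookup xs e))
    ∈-subset χ e χe = fromWitness {a? = selected? χ (lookup xs e)} (e , refl , χe)

    ∉-subset : ∀ χ e → χ e ≡ 0F → ¬ T (subset χ (lookup xs e))
    ∉-subset χ e χe t with toWitness {a? = selected? χ (lookup xs e)} t
    -- Uniqueness rules out that a second, marked position holds the same element.
    ... | e′ , eq , χe′ with refl ← lookup-injective !xs e′ e eq with () ← trans (sym χe) χe′

  -- The binary digits of a number below 2^m, with m the length of `xs`, serve as a characteristic
  -- function. Two numbers with the same image differ in some digit `e`; the one with digit 1 there
  -- supplies `S`.
  subsetCollision : (f : (A → Bool) → List Bool) → (∀ S → length (f S) < length xs) →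
                    ∃[ x ] ∃[ S ] ∃[ S′ ] x ∈ xs × T (S x) × ¬ T (S′ x) × f S ≡ f S′
  subsetCollision f short
    with i , j , i≢j , fi≡fj ← bitsPigeonhole (f ∘ subset ∘ finToFun {2}) (λ _ → short _)
    with e , differ ← finToFun-≢ {2} {length xs} i j i≢j
    with finToFun {2} i e in χe | finToFun {2} j e in χ′e
  ... | 0F | 0F = contradiction refl differ
  ... | 1F | 1F = contradiction refl differ
  ... | 1F | 0F = -, -, -, ∈-lookup e , ∈-subset (finToFun i) e χe , ∉-subset (finToFun j) e χ′e , fi≡fj
  ... | 0F | 1F = -, -, -, ∈-lookup e , ∈-subset (finToFun j) e χ′e , ∉-subset (finToFun i) e χe , sym fi≡fj

-- Forcing a stretched estimate

module _ {n} (G : Graph n) where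

  edges-unique : Unique (Graph.edges G)
  edges-unique = filter⁺ _ (cartesianProduct⁺ (allFin⁺ n) (allFin⁺ n))

  ∈-edges⁻ : ∀ {u v} → (u , v) ∈ Graph.edges G → u <ᶠ v × Adj G u v
  ∈-edges⁻ uv∈ = proj₂ (∈-filter⁻ (λ (u , v) → (u <? v) ×-dec T? (Graph.adjacent? G u v))
                                  {xs = cartesianProduct (allFin n) (allFin n)} uv∈)

-- The detour in `G` has at least g - 1 edges; the pendant edge supplies the missing one.
withPendants-far : ∀ {n} {G H : Graph n} {g u v} →
                   (∀ {x y} → Adj G x y → Adj H x y) → (∀ l → Cycle H l → g ≤ l) →
                   Adj H u v → ¬ Adj G u v →
                   ∀ d → IsEstimate (withPendants G) (pendant G u) (base G v) d → [ g ] ≤⁺ d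
withPendants-far G⊆H girth uv∈H uv∉G ⊤⁺    _ = _ ≤⊤⁺
withPendants-far {G = G} G⊆H girth uv∈H uv∉G [ l ] p with pendant-walk G p
... | l′ , l′<l , q = [ ≤-trans (girth≤detour G⊆H girth uv∈H uv∉G q) l′<l ]

module _ (O : DistanceOracle) {n} (H : Graph n) {g} (girth : ∀ l → Cycle H l → g ≤ l) where

  private
    open DistanceOracle O using (preprocess; query; estimate-valid)

    store : (Fin n × Fin n → Bool) → List Bool
    store S = preprocess (withPendants (subgraph H S))

    Stretched : Set
    Stretched = ∃[ G ] ∃[ u ] ∃[ v ] IsDistance {n + n} G u v [ 2 ] × [ g ] ≤⁺ estimate O G u v

    stretch : ∀ {u v} S S′ → u <ᶠ v → Adj H u v → T (S (u , v)) → ¬ T (S′ (u , v)) →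
              store S ≡ store S′ → Stretched
    stretch {u} {v} S S′ u<v uv∈H uv∈S uv∉S′ same =
      withPendants G , pendant G u , base G v ,
      pendant-distance G (subgraph-adj⁺ H S (u<v , uv∈H , uv∈S)) ,
      -- The numbering of the vertices does not depend on the graph, so the two queries agree once
      -- the stored bits do.
      subst (λ bits → [ g ] ≤⁺ query bits (pendant G u) (base G v)) (sym same)
        (withPendants-far (subgraph⊆ H S′) girth uv∈H uv∉G′ _
          (estimate-valid (withPendants G′) (pendant G′ u) (base G′ v)))
      where
      G  = subgraph H S
      G′ = subgraph H S′

      uv∉G′ : ¬ Adj G′ u v
      uv∉G′ uv with subgraph-adj⁻ H S′ uv
      ... | inj₁ (_ , _ , uv∈S′) = uv∉S′ uv∈S′
      ... | inj₂ (v<u , _)       = <ᶠ-asym u<v v<u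

  shortData⇒stretched : (∀ G → length (preprocess {n + n} G) < edgeCount H) → Stretched
  shortData⇒stretched short =
    let (u , v) , S , S′ , uv∈ , uv∈S , uv∉S′ , same =
          subsetCollision (≡-dec _≟ᶠ_ _≟ᶠ_) (edges-unique H) store (λ _ → short _)
        u<v , uv∈H = ∈-edges⁻ H uv∈
    in  stretch S S′ u<v uv∈H uv∈S uv∉S′ same

-- Space

^-distribʳ-* : ∀ k m n → (m * n) ^ k ≡ m ^ k * n ^ k
^-distribʳ-* zero    m n = refl
^-distribʳ-* (suc k) m n =
  trans (cong (m * n *_) (^-distribʳ-* k m n)) ([m*n]*[o*p]≡[m*o]*[n*p] m n (m ^ k) (n ^ k))

^-cancelˡ-< : ∀ k {m n} → m ^ k < n ^ k → m < n
^-cancelˡ-< k {m} {n} mᵏ<nᵏ = ≰⇒> (λ n≤m → <⇒≱ mᵏ<nᵏ (^-monoˡ-≤ k n≤m))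

-- In 4c + 1, the factor 4 pays for doubling the vertex set, as 2^(k+1) ≤ 4^k; the 1 makes s < m strict.
space<edges : ∀ k → 1 ≤ k → ∀ n → 1 ≤ n → ∀ c m s →
              n ^ suc k ≤ (c * m) ^ k → (suc (4 * c) * s) ^ k ≤ (n + n) ^ suc k → s < m
space<edges k@(suc _) 1≤k n@(suc _) _ c m s dense sparse = ≰⇒> λ m≤s →
  <-irrefl refl (begin-strict
    (4 * (c * m)) ^ k      <⟨ ^-monoˡ-< k (strictly m≤s) ⟩
    (suc (4 * c) * s) ^ k  ≤⟨ sparse ⟩
    (n + n) ^ suc k        ≡⟨ cong (λ x → (n + x) ^ suc k) (+-identityʳ n) ⟨
    (2 * n) ^ suc k        ≡⟨ ^-distribʳ-* (suc k) 2 n ⟩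
    2 ^ suc k * n ^ suc k  ≤⟨ *-mono-≤ 2^1+k≤4^k dense ⟩
    4 ^ k * (c * m) ^ k    ≡⟨ ^-distribʳ-* k 4 (c * m) ⟨
    (4 * (c * m)) ^ k      ∎)
  where
  open ≤-Reasoning

  2^1+k≤4^k : 2 ^ suc k ≤ 4 ^ k
  2^1+k≤4^k = begin
    2 ^ suc k    ≤⟨ ^-monoʳ-≤ 2 (+-monoˡ-≤ k 1≤k) ⟩
    2 ^ (k + k)  ≡⟨ cong (λ x → 2 ^ (k + x)) (+-identityʳ k) ⟨
    2 ^ (2 * k)  ≡⟨ ^-*-assoc 2 2 k ⟨
    4 ^ k        ∎

  0<cm : 0 < c * m
  -- As `k` is a successor, `0 ^ k` computes to 0.
  0<cm = ^-cancelˡ-< k (<-≤-trans (m^n>0 n (suc k)) dense)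

  0<m : 0 < m
  0<m = n≢0⇒n>0 λ { refl → <-irrefl (sym (*-zeroʳ c)) 0<cm }

  strictly : m ≤ s → 4 * (c * m) < suc (4 * c) * s
  strictly m≤s = begin-strict
    4 * (c * m)      ≡⟨ *-assoc 4 c m ⟨
    4 * c * m        ≤⟨ *-monoʳ-≤ (4 * c) m≤s ⟩
    4 * c * s        <⟨ m<n+m (4 * c * s) (<-≤-trans 0<m m≤s) ⟩
    suc (4 * c) * s  ∎

theorem3 : (k : ℕ) → 1 ≤ k → ErdősGirthConjecture →
    (O : DistanceOracle) (s : ℕ → ℕ) → UsesSpace O s → IsLittleO k s →
    ∃[ n ] ∃[ G ] ∃[ u ] ∃[ v ]
    IsDistance {n} G u v [ 2 ] × [ 2 * k + 2 ] ≤⁺ estimate O G u v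
theorem3 k 1≤k conjecture O s space little
  with c , N₁ , dense ← conjecture k 1≤k
  with N₂ , sparse ← little (suc (4 * c))
  -- Beyond both thresholds, and positive as `space<edges` requires.
  with n ← suc (N₁ ⊔ N₂) in n≡
  with N₁≤n ← subst (N₁ ≤_) n≡ (m≤n⇒m≤1+n (m≤m⊔n N₁ N₂))
  with N₂≤n ← subst (N₂ ≤_) n≡ (m≤n⇒m≤1+n (m≤n⊔m N₁ N₂))
  with H , m-large , g , isGirth , g-large ← dense n N₁≤n
  = n + n , shortData⇒stretched O H (≤girth⇒≤cycles {G = H} isGirth g-large) λ G →
    -- The oracle runs on `n + n` vertices, whereas the edges are those of `H` on `n` vertices.
    ≤-<-trans (space G)
      (space<edges k 1≤k n (subst (1 ≤_) n≡ (s≤s z≤n)) c (edgeCount H) (s (n + n)) m-large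
        (sparse (n + n) (≤-trans N₂≤n (m≤m+n n n))))
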